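{- Let $T$ be a (nonempty) top-cycle-free chord diagram. Then $T$ is 1-terminal if and only if the intersection graph of $T$ is a tree and every non-terminal chord of $T$ has exactly one right neighbor.
   Context: A chord diagram of size $n$ is a perfect matching of $\{1,\dots,2n\}$; chords are ordered pairs $(a,b)$ with $a<b$, $a$ the source and $b$ the sink. A subset of chords is a subdiagram, viewed as a diagram by order-preserving relabelling of endpoints. For chords $c_1=(a_1,b_1)$, $c_2=(a_2,b_2)$ with $a_1<a_2$, they cross if $a_2<b_1<b_2$, and then $c_2$ is a right neighbor of $c_1$. The intersection graph has chords as vertices and crossings as (undirected) edges. A chord is terminal if it has no right neighbors. A diagram is 1-terminal if no chord other than the last one, in the order of sources, is terminal. For $m\ge3$ the top cycle diagram of size $m$ is $T_m=\{(2i-1,2i+2):1\le i\le m-1\}\cup\{(2,2m-1)\}$; a diagram is top-cycle-free if no subdiagram of it equals (after relabelling) some $T_m$, $m\ge3$. -}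

module Defs where

open import Data.Fin.Base using (Fin; zero; suc; toℕ; fromℕ; fromℕ<; inject₁; combine; remQuot; _<_; _≤_)
open import Data.Fin.Properties using (<-irrefl; remQuot-combine; combine-remQuot; toℕ-combine; toℕ-fromℕ; toℕ-fromℕ<; toℕ-inject₁; toℕ-injective; toℕ<n)
open import Data.Fin.Relation.Unary.Top using (view; ‵fromℕ; ‵inject₁; view-fromℕ; view-inject₁)
open import Data.Nat.Base as ℕ using (ℕ; zero; suc; _+_; _*_; _∸_; z≤n; s≤s)
open import Data.Nat.Properties using (≤⇒≯; +-comm; +-identityʳ; *-suc; *-monoʳ-≤; n≤1+n; suc-injective; module ≤-Reasoning)
open import Data.Product using (Σ; ∃-syntax; ∃!; _×_; _,_)
open import Data.Sum.Base using (_⊎_; inj₁; inj₂; swap)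
open import Function.Base using (_∘_)
open import Function.Bundles using (_⇔_; mk⇔)
open import Function.Definitions using (Injective)
open import Level using (0ℓ)
open import Relation.Binary.Construct.Closure.ReflexiveTransitive using (Star)
open import Relation.Binary.Core using (Rel)
open import Relation.Binary.Definitions using (Irreflexive; Symmetric)
open import Relation.Binary.PropositionalEquality using (_≡_; _≢_; refl; sym; trans; cong; subst; subst₂; module ≡-Reasoning)
open import Relation.Nullary.Negation.Core using (¬_; contradiction)
open import Relation.Unary using (Pred; _∈_)

-- Cyclic successor: the last element is followed by zero.
next : ∀ {n} → Fin (suc n) → Fin (suc n)
next i with view i
... | ‵fromℕ     = zero
... | ‵inject₁ j = suc j

record Graph : Set₁ where
  field
    Vertex : Set
    Adj    : Rel Vertex 0ℓ
    symm   : Symmetric Adj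
    irrefl : Irreflexive _≡_ Adj

module _ (G : Graph) where
  open Graph G

  record Cycle : Set where
    field
      excess   : ℕ
    length : ℕ
    length = 3 + excess
    field
      vertex   : Fin length → Vertex
      distinct : Injective _≡_ _≡_ vertex
      adjacent : ∀ i → Adj (vertex i) (vertex (next i))

  record IsTree : Set where
    field
      nonempty  : Vertex
      connected : ∀ u v → Star Adj u v
      acyclic   : ¬ Cycle

-- A perfect matching of {1,…,2n}, given by the map sending each point to the
-- one it is matched with.  The point p is represented by x with toℕ x = p ∸ 1.
record Diagram (n : ℕ) : Set where
  field
    partner            : Fin (n * 2) → Fin (n * 2)
    partner-involutive : ∀ x → partner (partner x) ≡ x
    partner-≢          : ∀ x → partner x ≢ x

point : ∀ {k} → Fin k → ℕ
point x = suc (toℕ x)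

IsChord : ∀ {n} → Diagram n → Fin (n * 2) → Fin (n * 2) → Set
IsChord D a b = a < b × Diagram.partner D a ≡ b

record Chord {n : ℕ} (D : Diagram n) : Set where
  constructor chord
  field
    source  : Fin (n * 2)
    sink    : Fin (n * 2)
    isChord : IsChord D source sink

open Chord public

module _ {n : ℕ} {D : Diagram n} where

  _IsRightNeighborOf_ : Chord D → Chord D → Set
  d IsRightNeighborOf c = source c < source d × source d < sink c × sink c < sink d

  Cross : Rel (Chord D) 0ℓ
  Cross c d = d IsRightNeighborOf c ⊎ c IsRightNeighborOf d

  Terminal : Chord D → Set
  Terminal c = ¬ (∃[ d ] d IsRightNeighborOf c)

  IsLast : Chord D → Set
  IsLast c = ∀ (d : Chord D) → source d ≤ source c

module _ {n : ℕ} (D : Diagram n) where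

  intersectionGraph : Graph
  intersectionGraph = record
    { Vertex = Chord D
    ; Adj    = Cross
    ; symm   = swap
    ; irrefl = λ { refl (inj₁ (lt , _)) → <-irrefl refl lt
                 ; refl (inj₂ (lt , _)) → <-irrefl refl lt }
    }

  OneTerminal : Set
  OneTerminal = ∀ c → ¬ IsLast c → ¬ Terminal {D = D} c

  UniqueRightNeighbors : Set
  UniqueRightNeighbors =
    ∀ (c : Chord D) → ¬ Terminal c → ∃! _≡_ (_IsRightNeighborOf c)

  -- S is the subdiagram on the set X of chords of D.  The map unlabel is the
  -- inverse of the order-preserving relabelling of the endpoints of X, and
  -- X is exactly { (unlabel a , unlabel b) : (a , b) a chord of S }.
  record IsSubdiagram (X : Pred (Chord D) 0ℓ) {k : ℕ} (S : Diagram k) : Set where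
    field
      unlabel    : Fin (k * 2) → Fin (n * 2)
      increasing : ∀ {x y} → x < y → unlabel x < unlabel y
      into       : ∀ (d : Chord S) → ∃[ c ] c ∈ X ×
                     source c ≡ unlabel (source d) × sink c ≡ unlabel (sink d)
      onto       : ∀ c → c ∈ X → ∃[ d ]
                     source c ≡ unlabel (source {D = S} d) × sink c ≡ unlabel (sink d)

-- The chords of T_m, as pairs of points of {1,…,2m}.
TopCycleChord : ℕ → ℕ → ℕ → Set
TopCycleChord m a b =
  (∃[ i ] 1 ℕ.≤ i × i ℕ.≤ m ∸ 1 × a ≡ 2 * i ∸ 1 × b ≡ 2 * i + 2)
  ⊎ (a ≡ 2 × b ≡ 2 * m ∸ 1)

IsTopCycle : ∀ {m} → Diagram m → Set
IsTopCycle {m} S = 3 ℕ.≤ m ×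
  (∀ a b → IsChord S a b ⇔ TopCycleChord m (point a) (point b))

TopCycleFree : ∀ {n} → Diagram n → Set₁
TopCycleFree D =
  ¬ (∃[ X ] ∃[ m ] Σ (Diagram m) λ S → IsSubdiagram D X S × IsTopCycle S)

-- T_m exists for every m ≥ 3, so IsTopCycle is satisfiable.  Pairing the
-- points as (2i+1 , 2i+2) for i : Fin m, the partner of 2i+1 is the even point
-- of the cyclically next pair.
private

  prev : ∀ {n} → Fin (suc n) → Fin (suc n)
  prev zero    = fromℕ _
  prev (suc i) = inject₁ i

  next-fromℕ : ∀ n → next (fromℕ n) ≡ zero
  next-fromℕ n rewrite view-fromℕ n = refl

  next-inject₁ : ∀ {n} (i : Fin n) → next (inject₁ i) ≡ suc i
  next-inject₁ i rewrite view-inject₁ i = refl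

  next-prev : ∀ {n} (i : Fin (suc n)) → next (prev i) ≡ i
  next-prev zero    = next-fromℕ _
  next-prev (suc i) = next-inject₁ i

  prev-next : ∀ {n} (i : Fin (suc n)) → prev (next i) ≡ i
  prev-next i with view i
  ... | ‵fromℕ     = refl
  ... | ‵inject₁ _ = refl

  flip₂ : ∀ {n} → Fin (suc n) × Fin 2 → Fin (suc n) × Fin 2
  flip₂ (i , zero)     = next i , suc zero
  flip₂ (i , suc zero) = prev i , zero

  flip₂-involutive : ∀ {n} (p : Fin (suc n) × Fin 2) → flip₂ (flip₂ p) ≡ p
  flip₂-involutive (i , zero)     = cong (_, zero) (prev-next i)
  flip₂-involutive (i , suc zero) = cong (_, suc zero) (next-prev i)

  flip₂-≢ : ∀ {n} (p : Fin (suc n) × Fin 2) → flip₂ p ≢ p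
  flip₂-≢ (i , zero)     ()
  flip₂-≢ (i , suc zero) ()

  pair : ∀ {m} → Fin m × Fin 2 → Fin (m * 2)
  pair (i , j) = combine i j

  unpair : ∀ m → Fin (m * 2) → Fin m × Fin 2
  unpair _ = remQuot 2

  unpair-pair : ∀ {m} (p : Fin m × Fin 2) → unpair m (pair p) ≡ p
  unpair-pair (i , j) = remQuot-combine i j

topCycle : ∀ l → Diagram (3 + l)
topCycle l = record
  { partner            = λ x → pair (flip₂ (unpair m x))
  ; partner-involutive = λ x → begin
      pair (flip₂ (unpair m (pair (flip₂ (unpair m x)))))
        ≡⟨ cong (pair ∘ flip₂) (unpair-pair (flip₂ (unpair m x))) ⟩
      pair (flip₂ (flip₂ (unpair m x)))
        ≡⟨ cong pair (flip₂-involutive (unpair m x)) ⟩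
      pair (unpair m x)
        ≡⟨ combine-remQuot {m} 2 x ⟩
      x ∎
  ; partner-≢          = λ x eq → flip₂-≢ (unpair m x)
      (trans (sym (unpair-pair (flip₂ (unpair m x)))) (cong (unpair m) eq))
  }
  where
  open ≡-Reasoning
  m = 3 + l

module _ (l : ℕ) where

  private
    m = 3 + l
    open Diagram (topCycle l) using (partner)

    toℕ-even : (i : Fin m) → toℕ (pair (i , zero)) ≡ 2 * toℕ i
    toℕ-even i = trans (toℕ-combine i zero) (+-identityʳ _)

    toℕ-odd : (i : Fin m) → toℕ (pair (i , suc zero)) ≡ suc (2 * toℕ i)
    toℕ-odd i = trans (toℕ-combine i (suc zero)) (+-comm _ 1)

    partner-pair : (p : Fin m × Fin 2) → partner (pair p) ≡ pair (flip₂ p)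
    partner-pair p = cong (pair ∘ flip₂) (unpair-pair p)

    shift : ∀ k → suc (suc (2 * suc k)) ≡ 2 * suc k + 2
    shift k = +-comm 2 (2 * suc k)

    double : ∀ k → 2 * suc k ≡ suc (suc (2 * k))
    double k = *-suc 2 k

    forward : (p : Fin m × Fin 2) → pair p < pair (flip₂ p) →
              TopCycleChord m (point (pair p)) (point (pair (flip₂ p)))
    forward (i , zero) lt with view i
    ... | ‵fromℕ = contradiction lt (≤⇒≯ (begin
          toℕ (pair (zero {2 + l} , suc zero))      ≤⟨ s≤s z≤n ⟩
          2 * suc (suc l)                           ≡⟨ cong (2 *_) (toℕ-fromℕ (2 + l)) ⟨
          2 * toℕ (fromℕ (2 + l))                   ≡⟨ toℕ-even (fromℕ (2 + l)) ⟨
          toℕ (pair (fromℕ (2 + l) , zero))         ∎))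
      where open ≤-Reasoning
    ... | ‵inject₁ k = inj₁
          ( suc (toℕ k) , s≤s z≤n , toℕ<n k
          , trans (cong suc (trans (toℕ-even (inject₁ k)) (cong (2 *_) (toℕ-inject₁ k))))
                  (sym (cong (_∸ 1) (double (toℕ k))))
          , trans (cong suc (toℕ-odd (suc k))) (shift (toℕ k)))
    forward (zero , suc zero) lt = inj₂
      ( refl
      , trans (cong suc (trans (toℕ-even (fromℕ (2 + l))) (cong (2 *_) (toℕ-fromℕ (2 + l)))))
              (sym (cong (_∸ 1) (double (2 + l)))))
    forward (suc k , suc zero) lt = contradiction lt (≤⇒≯ (begin
          toℕ (pair (inject₁ k , zero))     ≡⟨ toℕ-even (inject₁ k) ⟩
          2 * toℕ (inject₁ k)               ≡⟨ cong (2 *_) (toℕ-inject₁ k) ⟩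
          2 * toℕ k                         ≤⟨ *-monoʳ-≤ 2 (n≤1+n (toℕ k)) ⟩
          2 * suc (toℕ k)                   ≤⟨ n≤1+n _ ⟩
          suc (2 * suc (toℕ k))             ≡⟨ toℕ-odd (suc k) ⟨
          toℕ (pair (suc k , suc zero))     ∎))
      where open ≤-Reasoning

    to : ∀ a b → IsChord (topCycle l) a b → TopCycleChord m (point a) (point b)
    to a b (lt , refl) =
      subst (λ x → TopCycleChord m (point x) (point (partner a)))
        (combine-remQuot {m} 2 a)
        (forward (unpair m a)
          (subst (_< partner a) (sym (combine-remQuot {m} 2 a)) lt))

    chordAt : ∀ (p : Fin m × Fin 2) {a b : Fin (m * 2)} → toℕ a ≡ toℕ (pair p) → toℕ b ≡ toℕ (pair (flip₂ p)) →
              a < b → IsChord (topCycle l) a b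
    chordAt p ea eb lt with refl ← toℕ-injective ea | refl ← toℕ-injective eb =
      lt , partner-pair p

    from : ∀ a b → TopCycleChord m (point a) (point b) → IsChord (topCycle l) a b
    from a b (inj₁ (suc t , _ , t≤ , ea , eb)) =
      chordAt (inject₁ k , zero) a≡ (trans b≡ (cong (toℕ ∘ pair ∘ (_, suc zero)) (sym (next-inject₁ k)))) a<b
      where
      k : Fin (2 + l)
      k = fromℕ< t≤

      a-val : toℕ a ≡ 2 * t
      a-val = suc-injective (trans ea (cong (_∸ 1) (double t)))

      b-val : toℕ b ≡ suc (2 * suc t)
      b-val = suc-injective (trans eb (sym (shift t)))

      a≡ : toℕ a ≡ toℕ (pair (inject₁ k , zero))
      a≡ = trans a-val (sym (trans (toℕ-even (inject₁ k))
             (cong (2 *_) (trans (toℕ-inject₁ k) (toℕ-fromℕ< t≤)))))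

      b≡ : toℕ b ≡ toℕ (pair {m} (suc k , suc zero))
      b≡ = trans b-val (sym (trans (toℕ-odd (suc k))
             (cong (λ z → suc (2 * suc z)) (toℕ-fromℕ< t≤))))

      a<b : a < b
      a<b = subst₂ ℕ._<_ (sym a-val) (sym b-val) (s≤s (*-monoʳ-≤ 2 (n≤1+n t)))
    from a b (inj₂ (ea , eb)) =
      chordAt (zero , suc zero) (suc-injective ea) b≡
        (subst₂ ℕ._<_ (sym (suc-injective ea)) (sym b-val) (*-monoʳ-≤ 2 {1} {2 + l} (s≤s z≤n)))
      where
      b-val : toℕ b ≡ 2 * (2 + l)
      b-val = suc-injective (trans eb (cong (_∸ 1) (double (2 + l))))

      b≡ : toℕ b ≡ toℕ (pair (fromℕ (2 + l) , zero {1}))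
      b≡ = trans b-val (sym (trans (toℕ-even (fromℕ (2 + l)))
             (cong (2 *_) (toℕ-fromℕ (2 + l)))))

  topCycle-isTopCycle : IsTopCycle (topCycle l)
  topCycle-isTopCycle =
    s≤s (s≤s (s≤s z≤n)) , λ a b → mk⇔ (to a b) (from a b)

{-# OPTIONS --safe #-}

-- If every chord but the last has a right neighbor, walking right from any chord
-- ends in the last chord, which gives connectedness.  The leftmost chord of a cycle
-- of the intersection graph has two right neighbors, so acyclicity follows from
-- uniqueness.  For uniqueness, let e and d be right neighbors of c with e to the
-- left of d.  Walk greedily from c, always to the right neighbor starting after e
-- whose sink is largest, until the walk leaves e on the right; by maximality chords
-- at distance two in the walk do not cross, so the walk together with e is a top cycle.
-- Conversely, if right neighbors are unique, whether the rightward walk from a chord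
-- reaches a given terminal chord is invariant along edges, so connectedness makes the
-- last chord the only terminal one.

module Submission where

open import Defs
open import Data.Bool.Base using (if_then_else_)
open import Data.Fin.Base using (Fin; zero; suc; toℕ; fromℕ; inject₁; _<_; _≤_; _>_)
open import Data.Fin.Induction using (<-wellFounded; >-wellFounded)
open import Data.Fin.Properties
  using ( _≟_; _<?_; any?; <-cmp; <-irrefl; <-irrelevant; <-trans; ≤-antisym
        ; toℕ<n; toℕ-fromℕ; toℕ-inject₁)
open import Data.Fin.Relation.Unary.Top using (view; ‵fromℕ; ‵inject₁; view-fromℕ; view-inject₁)
open import Data.Nat.Base as ℕ using (ℕ; NonZero; zero; suc; _+_; _*_; _∸_; z≤n; s≤s; z<s; s<s)
import Data.Nat.Properties as ℕ
open import Data.Product.Base using (∃-syntax; _×_; _,_; proj₁; proj₂)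
open import Data.Sum.Base using (_⊎_; inj₁; inj₂; swap)
open import Data.Unit.Base using (tt)
open import Function.Base using (_∘_; _on_; id)
open import Function.Bundles using (_⇔_; mk⇔; Equivalence)
open import Induction.WellFounded using (WellFounded; Acc; acc)
open import Level using (0ℓ)
open import Relation.Binary.Construct.Closure.ReflexiveTransitive using (Star; ε; _◅_; _◅◅_; gmap; reverse)
import Relation.Binary.Construct.On as On
open import Relation.Binary.Core using (Rel)
open import Relation.Binary.Definitions as Binary using (tri<; tri≈; tri>)
open import Relation.Binary.PropositionalEquality
  using (_≡_; _≢_; refl; sym; trans; cong; subst; subst₂)
open import Relation.Nullary.Decidable
  using (Dec; yes; no; does; _×-dec_; map′; dec-true; dec-false; decidable-stable)
open import Relation.Nullary.Negation.Core using (¬_; contradiction)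
open import Relation.Unary using (Decidable)

-- The cyclic successor.

next-fromℕ : ∀ n → next (fromℕ n) ≡ zero
next-fromℕ n rewrite view-fromℕ n = refl

next-inject₁ : ∀ {n} (i : Fin n) → next (inject₁ i) ≡ suc i
next-inject₁ i rewrite view-inject₁ i = refl

next-surjective : ∀ {n} (i : Fin (suc n)) → ∃[ j ] next j ≡ i
next-surjective zero    = fromℕ _ , next-fromℕ _
next-surjective (suc i) = inject₁ i , next-inject₁ i

toℕ-next : ∀ {n} (i : Fin (suc n)) →
           toℕ (next i) ≡ suc (toℕ i) ⊎ (toℕ i ≡ n × next i ≡ zero)
toℕ-next {n} i with view i
... | ‵fromℕ     = inj₂ (toℕ-fromℕ n , refl)
... | ‵inject₁ j = inj₁ (cong suc (sym (toℕ-inject₁ j)))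

-- Separates the two neighbors of a vertex on a cycle; the length must be at least three.
next²-≢ : ∀ {n} (i : Fin (3 + n)) → next (next i) ≢ i
next²-≢ i eq with toℕ-next i | toℕ-next (next i)
... | inj₁ p       | inj₁ q       =
  ℕ.m≢1+m+n _ (trans (cong toℕ (sym eq)) (trans q (cong suc (trans p (ℕ.+-comm 1 _)))))
... | inj₁ p       | inj₂ (q , r) with refl ← trans (sym r) eq =
  contradiction (trans (sym p) q) λ ()
... | inj₂ (p , q) | inj₁ r       rewrite q =
  contradiction (trans (sym r) (trans (cong toℕ eq) p)) λ ()
... | inj₂ (p , q) | inj₂ (r , _) rewrite q = contradiction r λ ()

-- Extremal elements and interleaved sequences.

minimal : ∀ {A : Set} {_≺_ : Rel A 0ℓ} → WellFounded _≺_ → Binary.Decidable _≺_ →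
          (∀ {Q : A → Set} → Decidable Q → Dec (∃[ x ] Q x)) →
          ∀ {P : A → Set} → Decidable P → ∀ a → P a →
          ∃[ b ] P b × (∀ x → P x → ¬ x ≺ b)
minimal {_≺_ = _≺_} wf _≺?_ search {P} P? a = go a (wf a)
  where
  go : ∀ a → Acc _≺_ a → P a → ∃[ b ] P b × (∀ x → P x → ¬ x ≺ b)
  -- Deciding whether a smaller witness exists stands in for excluded middle.
  go a (acc rs) pa with search (λ x → P? x ×-dec (x ≺? a))
  ... | yes (x , px , x≺a) = go x (rs x≺a) px
  ... | no  none           = a , pa , λ x px x≺a → none (x , px , x≺a)

interleave : ∀ {X : Set} → (ℕ → X) → (ℕ → X) → ℕ → X
interleave f g zero    = f zero
interleave f g (suc x) = interleave g (f ∘ suc) x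

interleave-even : ∀ {X : Set} (f g : ℕ → X) j → interleave f g (j * 2) ≡ f j
interleave-even f g zero    = refl
interleave-even f g (suc j) = interleave-even (f ∘ suc) (g ∘ suc) j

interleave-odd : ∀ {X : Set} (f g : ℕ → X) j → interleave f g (suc (j * 2)) ≡ g j
interleave-odd f g zero    = refl
interleave-odd f g (suc j) = interleave-odd (f ∘ suc) (g ∘ suc) j

module _ {X : Set} (_⊏_ : Rel X 0ℓ) where

  interleave-step : ∀ m (f g : ℕ → X) →
                    (∀ j → j ℕ.< m → f j ⊏ g j) →
                    (∀ j → suc j ℕ.< m → g j ⊏ f (suc j)) →
                    ∀ x → suc x ℕ.< m * 2 → interleave f g x ⊏ interleave f g (suc x)
  interleave-step (suc m)       f g fg gf zero          lt = fg zero z<s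
  interleave-step (suc (suc m)) f g fg gf (suc zero)    lt = gf zero (s<s z<s)
  interleave-step (suc zero)    f g fg gf (suc zero)    (s≤s (s≤s ()))
  -- Dropping one term of each sequence lowers both the position and the bound `m * 2` by two.
  interleave-step (suc m)       f g fg gf (suc (suc x)) (s≤s (s≤s lt)) =
    interleave-step m (f ∘ suc) (g ∘ suc)
      (λ j → fg (suc j) ∘ s<s) (λ j → gf (suc j) ∘ s<s) x lt

  step⇒increasing : (∀ {x y z} → x ⊏ y → y ⊏ z → x ⊏ z) →
                    ∀ {N} (u : ℕ → X) → (∀ x → suc x ℕ.< N → u x ⊏ u (suc x)) →
                    ∀ {x y} → x ℕ.< y → y ℕ.< N → u x ⊏ u y
  step⇒increasing ⊏-trans u step {x} {suc y} (s≤s x≤y) y<N with ℕ.m≤n⇒m<n∨m≡n x≤y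
  ... | inj₁ x<y  = ⊏-trans (step⇒increasing ⊏-trans u step x<y (ℕ.<⇒≤ y<N)) (step y y<N)
  ... | inj₂ refl = step y y<N

-- Chords and their endpoints.

module _ {n : ℕ} (D : Diagram n) where
  open Diagram D

  private
    Point = Fin (n * 2)
    _→ʳ_ : Rel (Chord D) 0ℓ
    c →ʳ d = d IsRightNeighborOf c

  source-injective : ∀ (c d : Chord D) → source c ≡ source d → c ≡ d
  source-injective (chord s _ (p , refl)) (chord .s _ (q , refl)) refl =
    cong (λ r → chord s _ (r , refl)) (<-irrelevant p q)

  partner-sink : (c : Chord D) → partner (sink c) ≡ source c
  partner-sink (chord s _ (_ , refl)) = partner-involutive s

  sink-injective : ∀ (c d : Chord D) → sink c ≡ sink d → c ≡ d
  sink-injective c d eq =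
    source-injective c d (trans (sym (partner-sink c)) (trans (cong partner eq) (partner-sink d)))

  -- Taking partners would also give `sink c ≡ source d`, so `c` and `d` would be one pair of points
  -- in opposite orders.
  source≢sink : ∀ (c d : Chord D) → source c ≢ sink d
  source≢sink c d eq = ℕ.<-asym (proj₁ (isChord c))
    (subst₂ _<_ (sym sink≡source) (sym eq) (proj₁ (isChord d)))
    where
    sink≡source : sink c ≡ source d
    sink≡source = trans (sym (proj₂ (isChord c))) (trans (cong partner eq) (partner-sink d))

  -- A chord is fixed by its source, so the search can run over points.
  anyChord? : ∀ {P : Chord D → Set} → Decidable P → Dec (∃[ c ] P c)
  anyChord? {P} P? = map′ to from (any? source?)
    where
    At : Point → Set
    At x = ∃[ lt ] P (chord x (partner x) (lt , refl))

    source? : Decidable At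
    source? x with x <? partner x
    ... | no  ≮  = no (≮ ∘ proj₁)
    ... | yes lt = map′ (lt ,_)
                     (λ { (lt′ , p) → subst (λ r → P (chord x _ (r , refl))) (<-irrelevant lt′ lt) p })
                     (P? _)

    to : (∃[ x ] At x) → ∃[ c ] P c
    to (x , lt , p) = chord x (partner x) (lt , refl) , p

    from : (∃[ c ] P c) → ∃[ x ] At x
    from (chord x _ (lt , refl) , p) = x , lt , p

  someChord : Point → Chord D
  someChord x with <-cmp x (partner x)
  ... | tri< lt _ _ = chord x (partner x) (lt , refl)
  ... | tri≈ _ eq _ = contradiction (sym eq) (partner-≢ x)
  ... | tri> _ _ gt = chord (partner x) x (gt , partner-involutive x)

  rightNeighbor? : ∀ (c : Chord D) → Decidable (_IsRightNeighborOf c)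
  rightNeighbor? c d =
    (source c <? source d) ×-dec ((source d <? sink c) ×-dec (sink c <? sink d))

  nonTerminal⇒rightNeighbor : ∀ (c : Chord D) → ¬ Terminal c → ∃[ d ] d IsRightNeighborOf c
  nonTerminal⇒rightNeighbor c = decidable-stable (anyChord? (rightNeighbor? c))

  maximal : (key : Chord D → Point) → ∀ {P : Chord D → Set} → Decidable P →
            ∀ c → P c → ∃[ d ] P d × (∀ x → P x → ¬ key d < key x)
  maximal key = minimal (On.wellFounded key >-wellFounded) (λ c d → key d <? key c) anyChord?

  lastChord : Point → ∃[ ℓ ] IsLast {D = D} ℓ
  lastChord x with maximal source (λ _ → yes tt) (someChord x) tt
  ... | ℓ , _ , max = ℓ , λ d → ℕ.≮⇒≥ (max d tt)

  last-unique : ∀ (c ℓ : Chord D) → IsLast c → IsLast ℓ → c ≡ ℓ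
  last-unique c ℓ lc lℓ = source-injective c ℓ (≤-antisym (lℓ c) (lc ℓ))

  last⇒terminal : ∀ (ℓ : Chord D) → IsLast ℓ → Terminal ℓ
  last⇒terminal ℓ isLast (d , lt , _) = ℕ.<⇒≱ lt (isLast d)

  -- Rightward paths.

  _⟶*_ : Rel (Chord D) 0ℓ
  _⟶*_ = Star _→ʳ_

  -- Once every chord has a path to the last chord, this makes the last chord's sink the largest.
  sink-mono : ∀ {c d} → c ⟶* d → sink c ≤ sink d
  sink-mono ε                     = ℕ.≤-refl
  sink-mono ((_ , _ , lt) ◅ path) = ℕ.≤-trans (ℕ.<⇒≤ lt) (sink-mono path)

  -- Consequences of unique right neighbors.

  module _ (unique : UniqueRightNeighbors D) where

    terminal-⟶* : ∀ {c d : Chord D} → Terminal c → c ⟶* d → c ≡ d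
    terminal-⟶* t ε                 = refl
    terminal-⟶* t (_◅_ {j = d} r _) = contradiction (d , r) t

    cross-⟶* : ∀ {c d ℓ : Chord D} → Terminal ℓ → Cross c d → d ⟶* ℓ → c ⟶* ℓ
    cross-⟶* t (inj₁ c→d) path = c→d ◅ path
    cross-⟶* {c} t (inj₂ d→c) ε = contradiction (c , d→c) t
    -- By uniqueness the path from `d` steps first to `c`, so its remainder starts at `c`.
    cross-⟶* {c} {d} t (inj₂ d→c) (_◅_ {j = x} d→x path) =
      let _ , _ , ≡r = unique d (λ t′ → t′ (c , d→c))
      in subst (_⟶* _) (trans (sym (≡r {x} d→x)) (≡r {c} d→c)) path

    connected-⟶* : ∀ {c ℓ : Chord D} → Terminal ℓ → Star Cross c ℓ → c ⟶* ℓ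
    connected-⟶* t ε          = ε
    connected-⟶* t (x ◅ path) = cross-⟶* t x (connected-⟶* t path)

    unique⇒oneTerminal : Point → (∀ c d → Star Cross c d) → OneTerminal D
    unique⇒oneTerminal x connected c notLast t with lastChord x
    ... | ℓ , isLast = notLast (subst (IsLast {D = D}) (sym c≡ℓ) isLast)
      where
      c≡ℓ : c ≡ ℓ
      -- A rightward path out of the terminal chord `c` has no steps.
      c≡ℓ = terminal-⟶* t (connected-⟶* (last⇒terminal ℓ isLast) (connected c ℓ))

    acyclic : ¬ Cycle (intersectionGraph D)
    acyclic cyc with minimal (On.wellFounded (source ∘ vertex) <-wellFounded)
                       (λ i j → source (vertex i) <? source (vertex j)) any?
                       (λ _ → yes tt) zero tt
      where open Cycle cyc
    -- Writing the minimum as `next j` exposes its cyclic predecessor `j` alongside its successor.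
    ... | i , _ , min with next-surjective i
    ... | j , refl = next²-≢ j (distinct (trans (sym (≡r {vertex (next (next j))} after)) (≡r {vertex j} before)))
      where
      open Cycle cyc
      right : ∀ k → Cross (vertex (next j)) (vertex k) →
              vertex k IsRightNeighborOf vertex (next j)
      right k (inj₁ r)        = r
      right k (inj₂ (lt , _)) = contradiction lt (min k tt)

      before : vertex j IsRightNeighborOf vertex (next j)
      before = right j (swap (adjacent j))

      after : vertex (next (next j)) IsRightNeighborOf vertex (next j)
      after = right (next (next j)) (adjacent (next j))

      ≡r = proj₂ (proj₂ (unique (vertex (next j)) (λ t → t (vertex j , before))))

  -- Greedy walks and the top cycles they produce.

  module _ (e : Chord D) where

    RightAfter : Rel (Chord D) 0ℓ
    RightAfter c d = d IsRightNeighborOf c × source e < source d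

    rightAfter? : ∀ c → Decidable (RightAfter c)
    rightAfter? c d = rightNeighbor? c d ×-dec (source e <? source d)

    Greedy : Rel (Chord D) 0ℓ
    Greedy c d = RightAfter c d × (∀ x → RightAfter c x → ¬ sink d < sink x)

    -- The walk proper runs from `walk 0` to `walk (suc size)`, and only its last chord ends beyond
    -- `e`. Together with `e` these are `3 + size` chords.
    record Escape (c : Chord D) : Set where
      field
        size   : ℕ
        walk   : ℕ → Chord D
        start  : walk 0 ≡ c
        inside : ∀ {i} → i ℕ.≤ size → sink (walk i) < sink e
        greedy : ∀ {i} → i ℕ.≤ size → Greedy (walk i) (walk (suc i))
        exit   : sink e < sink (walk (suc size))

    -- The recursion is on the sink, which grows at every step. The walk cannot land exactly on
    -- `sink e`: that chord would be `e`, which does not start after itself.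
    escape : (∀ d → sink d < sink e → ∃[ x ] x IsRightNeighborOf d) →
             ∀ c → sink c < sink e → (∃[ d ] RightAfter c d) → Escape c
    escape continue c = go c (On.wellFounded sink >-wellFounded c)
      where
      go : ∀ c → Acc (_>_ on sink) c → sink c < sink e → (∃[ d ] RightAfter c d) → Escape c
      go c (acc rs) c<e (d₀ , r₀) with maximal sink (rightAfter? c) d₀ r₀
      ... | d , r@((_ , _ , c<d) , e<d) , max with <-cmp (sink d) (sink e)
      ...   | tri≈ _ eq _ = contradiction e<d (<-irrefl (cong source (sym (sink-injective d e eq))))
      ...   | tri> _ _ gt = record
        { size   = 0
        ; walk   = λ { zero → c ; (suc _) → d }
        ; start  = refl
        ; inside = λ { z≤n → c<e }
        ; greedy = λ { z≤n → r , max }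
        ; exit   = gt
        }
      ...   | tri< lt _ _ with continue d lt
      ...     | x , d→x = record
        { size   = suc size
        ; walk   = λ { zero → c ; (suc i) → walk i }
        ; start  = refl
        ; inside = λ { {zero} _ → c<e ; {suc i} (s≤s i≤) → inside i≤ }
        ; greedy = λ { {zero} _ → subst (Greedy c) (sym start) (r , max)
                     ; {suc i} (s≤s i≤) → greedy i≤ }
        ; exit   = exit
        }
        -- A right neighbor of `d` starts after `d`, hence after `e`.
        where open Escape (go d (rs c<d) lt (x , d→x , <-trans e<d (proj₁ d→x)))

    module _ {c : Chord D} (c→e : e IsRightNeighborOf c) (escaping : Escape c) where
      open Escape escaping

      -- Otherwise `walk (2 + i)` would be a candidate for the step from `walk i`, with a larger
      -- sink than the greedy choice `walk (suc i)`.
      walk-induced : ∀ {i} → i ℕ.< size → sink (walk i) < source (walk (2 + i))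
      walk-induced {i} i<size with greedy (ℕ.<⇒≤ i<size) | greedy i<size
      ... | (((s₀<s₁ , _ , t₀<t₁) , e<s₁) , max) | (((s₁<s₂ , _ , t₁<t₂) , e<s₂) , _)
        with <-cmp (sink (walk i)) (source (walk (2 + i)))
      ... | tri< lt _ _ = lt
      ... | tri≈ _ eq _ = contradiction (sym eq) (source≢sink (walk (2 + i)) (walk i))
      ... | tri> _ _ gt = contradiction t₁<t₂
        (max (walk (2 + i)) ((<-trans s₀<s₁ s₁<s₂ , gt , <-trans t₀<t₁ t₁<t₂) , e<s₂))

      m : ℕ
      m = 3 + size

      -- The endpoints of the top cycle are first 0 < second 0 < first 1 < second 1 < ….
      first second : ℕ → Point
      first j = if does (j ℕ.≤? suc size) then source (walk j) else sink e
      second zero    = source e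
      second (suc j) = sink (walk j)

      first-≤ : ∀ {j} → j ℕ.≤ suc size → first j ≡ source (walk j)
      first-≤ {j} j≤ rewrite dec-true (j ℕ.≤? suc size) j≤ = refl

      first-last : first (2 + size) ≡ sink e
      first-last rewrite dec-false (2 + size ℕ.≤? suc size) ℕ.1+n≰n = refl

      -- The reasons, in turn: `c` starts before `e`, consecutive chords of the walk cross, and the
      -- last one ends beyond `e`.
      first<second : ∀ j → j ℕ.< m → first j < second j
      first<second zero    _ = subst (λ x → source x < source e) (sym start) (proj₁ c→e)
      first<second (suc j) (s<s j<) with ℕ.m≤n⇒m<n∨m≡n (ℕ.s≤s⁻¹ j<)
      ... | inj₁ j≤@(s≤s j≤size) rewrite first-≤ j≤ = proj₁ (proj₂ (proj₁ (proj₁ (greedy j≤size))))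
      ... | inj₂ refl            rewrite first-last = exit

      -- The reasons, in turn: `walk 1` starts after `e`, chords at distance two do not cross, and
      -- `walk size` ends before `e`.
      second<first : ∀ j → suc j ℕ.< m → second j < first (suc j)
      second<first zero    _ = proj₂ (proj₁ (greedy z≤n))
      second<first (suc j) (s<s (s<s j≤)) with ℕ.m≤n⇒m<n∨m≡n (ℕ.s≤s⁻¹ j≤)
      ... | inj₁ j< rewrite first-≤ (s≤s j<) = walk-induced j<
      ... | inj₂ refl rewrite first-last = inside ℕ.≤-refl

      endpoint : ℕ → Point
      endpoint = interleave first second

      -- Counting from zero, the top cycle joins `first j` to `second (suc j)`, which is `walk j`,
      -- and `second 0` to `first (2 + size)`, which is `e`.
      chordWithEndpoints : ∀ {a b : Fin (m * 2)} → TopCycleChord m (point a) (point b) →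
                           ∃[ x ] source x ≡ endpoint (toℕ a) × sink x ≡ endpoint (toℕ b)
      chordWithEndpoints {a} {b} (inj₁ (suc j , _ , s≤s j≤ , a≡ , b≡)) =
        walk j
        , sym (trans (cong endpoint a-val) (trans (interleave-even first second j) (first-≤ j≤)))
        , sym (trans (cong endpoint b-val) (interleave-odd first second (suc j)))
        where
        a-val : toℕ a ≡ j * 2
        a-val = ℕ.suc-injective (trans a≡ (cong (_∸ 1) (ℕ.*-comm 2 (suc j))))
        b-val : toℕ b ≡ suc (suc j * 2)
        b-val = ℕ.suc-injective
          (trans b≡ (trans (cong (_+ 2) (ℕ.*-comm 2 (suc j))) (ℕ.+-comm _ 2)))
      chordWithEndpoints {a} {b} (inj₂ (a≡ , b≡)) =
        e
        , sym (cong endpoint (ℕ.suc-injective a≡))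
        , sym (trans (cong endpoint b-val) (trans (interleave-even first second (2 + size)) first-last))
        where
        b-val : toℕ b ≡ (2 + size) * 2
        b-val = ℕ.suc-injective (trans b≡ (cong (_∸ 1) (ℕ.*-comm 2 m)))

      escape⇒¬topCycleFree : ¬ TopCycleFree D
      escape⇒¬topCycleFree free =
        free (X , m , S , subdiagram , topCycle-isTopCycle size)
        where
        S : Diagram m
        S = topCycle size

        unlabel : Fin (m * 2) → Point
        unlabel = endpoint ∘ toℕ

        -- With `X` chosen as the chords that come from `S`, `onto` is immediate, and `into` asks
        -- that each chord of `S` land on a chord of `D`.
        X : Chord D → Set
        X x = ∃[ d ] source x ≡ unlabel (source {D = S} d) × sink x ≡ unlabel (sink d)

        subdiagram : IsSubdiagram D X S
        subdiagram = record
          { unlabel    = unlabel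
          ; increasing = λ {x} {y} x<y →
              step⇒increasing _<_ ℕ.<-trans endpoint
                (interleave-step _<_ m first second first<second second<first) x<y (toℕ<n y)
          ; into       = into
          ; onto       = λ _ x∈X → x∈X
          }
          where
          into : ∀ (d : Chord S) → ∃[ x ] X x × source x ≡ unlabel (source d) × sink x ≡ unlabel (sink d)
          into d =
            let x , ends = chordWithEndpoints
                             (Equivalence.to (proj₂ (topCycle-isTopCycle size) _ _) (isChord d))
            in x , (d , ends) , ends

  -- Consequences of 1-terminality.

  module _ (oneTerminal : OneTerminal D) (x : Point) where

    -- The point `x` witnesses that the diagram is nonempty, so a last chord exists.
    ℓ : Chord D
    ℓ = proj₁ (lastChord x)

    rightNeighbor : ∀ c → c ≢ ℓ → ∃[ d ] d IsRightNeighborOf c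
    rightNeighbor c c≢ℓ = nonTerminal⇒rightNeighbor c
      (oneTerminal c λ isLast → c≢ℓ (last-unique c ℓ isLast (proj₂ (lastChord x))))

    ⟶*-last : ∀ c → c ⟶* ℓ
    ⟶*-last c = go c (On.wellFounded source >-wellFounded c)
      where
      go : ∀ c → Acc (_>_ on source) c → c ⟶* ℓ
      go c (acc rs) with source c ≟ source ℓ
      ... | yes eq = subst (c ⟶*_) (source-injective c ℓ eq) ε
      ... | no  ne with rightNeighbor c (ne ∘ cong source)
      ...   | d , r = r ◅ go d (rs (proj₁ r))

    connected : ∀ c d → Star Cross c d
    connected c d = gmap id inj₁ (⟶*-last c) ◅◅ reverse swap (gmap id inj₁ (⟶*-last d))

    unique : TopCycleFree D → UniqueRightNeighbors D
    unique free c t with nonTerminal⇒rightNeighbor c t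
    ... | d , c→d = d , c→d , λ {d′} c→d′ → equal d d′ c→d c→d′
      where
      continue : ∀ e d → sink d < sink e → ∃[ x ] x IsRightNeighborOf d
      -- If `d` were `ℓ`, the path from `e` to `ℓ` would give `sink e ≤ sink d`.
      continue e d d<e = rightNeighbor d λ { refl → ℕ.<⇒≱ d<e (sink-mono (⟶*-last e)) }

      -- The chord starting first is the one to escape; the other guarantees that the greedy walk
      -- has a first step.
      sourcesUnordered : ∀ e d → e IsRightNeighborOf c → d IsRightNeighborOf c →
                         ¬ source e < source d
      sourcesUnordered e d c→e c→d e<d = escape⇒¬topCycleFree e c→e
        (escape e (continue e) c (proj₂ (proj₂ c→e)) (d , c→d , e<d)) free

      equal : ∀ d d′ → d IsRightNeighborOf c → d′ IsRightNeighborOf c → d ≡ d′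
      equal d d′ c→d c→d′ with <-cmp (source d) (source d′)
      ... | tri< lt _ _ = contradiction lt (sourcesUnordered d d′ c→d c→d′)
      ... | tri≈ _ eq _ = source-injective d d′ eq
      ... | tri> _ _ gt = contradiction gt (sourcesUnordered d′ d c→d′ c→d)

lemma8p4 : ∀ (n : ℕ) .{{_ : NonZero n}} (T : Diagram n) → TopCycleFree T →
    OneTerminal T ⇔ (IsTree (intersectionGraph T) × UniqueRightNeighbors T)
lemma8p4 (suc n) T free = mk⇔
  (λ oneTerminal → let unique! = unique T oneTerminal zero free in
    record
      { nonempty  = ℓ T oneTerminal zero
      ; connected = connected T oneTerminal zero
      ; acyclic   = acyclic T unique!
      } , unique!)
  (λ { (tree , unique!) → unique⇒oneTerminal T unique! zero (IsTree.connected tree) })
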